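{- Let $m,n\ge 1$, let $\mathbf r=(r_1,\dots,r_m)$ and $\mathbf c=(c_1,\dots,c_n)$ be vectors of strictly positive integers with $\sum_{i=1}^m r_i=\sum_{j=1}^n c_j$, and let $k,l\in\{1,\dots,m\}$. Then the boolean formula $F_{k,l}(\mathbf r,\mathbf c)$ (defined in the context) is satisfiable if and only if $(\mathbf r,\mathbf c)$ has a realization $T\subseteq\{1,\dots,m\}\times\{1,\dots,n\}$ that is an hv-convex polyomino anchored at $(k,l)$.
   Context: An object is a subset $T$ of the cells of the grid $\{1,\dots,m\}\times\{1,\dots,n\}$, where $(i,j)$ is the cell in row $i$ and column $j$; it is identified with an $m\times n$ 0-1 matrix ($T_{i,j}=1$ iff $(i,j)\in T$). $T$ is a realization of $(\mathbf r,\mathbf c)$ if $\sum_j T_{i,j}=r_i$ for all $i$ and $\sum_i T_{i,j}=c_j$ for all $j$. $T$ is a polyomino if the graph whose vertices are the cells of $T$, with $(i,j)$ and $(i',j')$ adjacent iff $|i-i'|+|j-j'|\le 1$, is connected. $T$ is h-convex if $(i,p),(i,q)\in T$ implies $(i,j)\in T$ for all $p\le j\le q$; v-convexity is defined analogously for columns; $T$ is hv-convex if it is both. An hv-convex polyomino $T$ is anchored at $(k,l)$ if $(k,1)\in T$ and $(l,n)\in T$. The formula $F_{k,l}(\mathbf r,\mathbf c)$ has boolean variables $A_{i,j},B_{i,j},C_{i,j},D_{i,j}$ for $1\le i\le m$, $1\le j\le n$. A bar denotes negation. Any of the symbols $A_{i,j},B_{i,j},C_{i,j},D_{i,j}$ with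 $(i,j)\notin\{1,\dots,m\}\times\{1,\dots,n\}$ denotes the constant 1 (true), so its negation is false. Define $F_{k,l}(\mathbf r,\mathbf c)=\mathit{Cor}\wedge\mathit{Dis}\wedge\mathit{Con}\wedge\mathit{Anc}\wedge\mathit{LBC}\wedge\mathit{UBR}$, where the following are conjunctions of the listed clauses, with $i$ ranging over $\{1,\dots,m\}$ (subject to any stated restriction) and $j$ over $\{1,\dots,n\}$: - $\mathit{Cor}$: for all $i,j$: $A_{i,j}\Rightarrow A_{i-1,j}$, $A_{i,j}\Rightarrow A_{i,j-1}$, $B_{i,j}\Rightarrow B_{i-1,j}$, $B_{i,j}\Rightarrow B_{i,j+1}$, $C_{i,j}\Rightarrow C_{i+1,j}$, $C_{i,j}\Rightarrow C_{i,j-1}$, $D_{i,j}\Rightarrow D_{i+1,j}$, $D_{i,j}\Rightarrow D_{i,j+1}$. - $\mathit{Dis}$: for all $i,j$ and all distinct symbols $X,Y\in\{A,B,C,D\}$: $X_{i,j}\Rightarrow\overline{Y}_{i,j}$. - $\mathit{Con}$: for all $i,j$: $A_{i,j}\Rightarrow\overline{D}_{i+1,j+1}$ and $B_{i,j}\Rightarrow\overline{C}_{i+1,j-1}$. - $\mathit{Anc}$: $\overline{A}_{k,1}\wedge\overline{B}_{k,1}\wedge\overline{C}_{k,1}\wedge\overline{D}_{k,1}\wedge\overline{A}_{l,n}\wedge\overline{B}_{l,n}\wedge\overline{C}_{l,n}\wedge\overline{D}_{l,n}$. - $\mathit{LBC}$: for all $i,j$: $A_{i,j}\Rightarrow\overline{C}_{i+c_j,j}$,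 $A_{i,j}\Rightarrow\overline{D}_{i+c_j,j}$, $B_{i,j}\Rightarrow\overline{C}_{i+c_j,j}$, $B_{i,j}\Rightarrow\overline{D}_{i+c_j,j}$; and for all $j$: $\overline{C}_{c_j,j}$ and $\overline{D}_{c_j,j}$. - $\mathit{UBR}$: for all $j$: $\overline{A}_{i,j}\Rightarrow B_{i,j+r_i}$ for all $i\le\min\{k,l\}$; $\overline{C}_{i,j}\Rightarrow B_{i,j+r_i}$ for all $i$ with $k\le i\le l$; $\overline{A}_{i,j}\Rightarrow D_{i,j+r_i}$ for all $i$ with $l\le i\le k$; $\overline{C}_{i,j}\Rightarrow D_{i,j+r_i}$ for all $i\ge\max\{k,l\}$. -}

module Defs where

open import Data.Bool.Base using (Bool; true; not; _∧_; _∨_; if_then_else_)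
open import Data.Fin.Base using (Fin; zero; fromℕ; fromℕ<; toℕ; _≤_)
open import Data.Maybe.Base using (Maybe; just; nothing)
open import Data.Nat.Base as ℕ using (ℕ; zero; suc; _+_; _∸_; _⊓_; _⊔_; ∣_-_∣; NonZero)
open import Data.Nat.Properties using (+-0-commutativeMonoid; _≤?_; _<?_)
open import Data.Product.Base using (Σ-syntax; ∃-syntax; _×_; _,_)
open import Data.Vec.Functional using (Vector; foldr)
open import Algebra.Properties.CommutativeMonoid.Sum +-0-commutativeMonoid public using (sum)
open import Relation.Binary.Construct.Closure.ReflexiveTransitive using (Star)
open import Relation.Binary.PropositionalEquality.Core using (_≡_)
open import Relation.Nullary.Decidable.Core using (Dec; yes; no; does)


-- The index set {1,…,n} is represented by Fin n; # i is the 1-based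
-- number of the index i.
#_ : ∀ {n} → Fin n → ℕ
# i = suc (toℕ i)

infix 9 #_

first last : ∀ {n} .{{_ : NonZero n}} → Fin n
first {suc n} = zero
last  {suc n} = fromℕ n

Object : ℕ → ℕ → Set
Object m n = Fin m → Fin n → Bool

Cell : ℕ → ℕ → Set
Cell m n = Fin m × Fin n

infix 4 _∈_

_∈_ : ∀ {m n} → Cell m n → Object m n → Set
(i , j) ∈ T = T i j ≡ true

entry : Bool → ℕ
entry b = if b then 1 else 0

IsRealization : ∀ {m n} → Vector ℕ m → Vector ℕ n → Object m n → Set
IsRealization r c T =
  (∀ i → sum (λ j → entry (T i j)) ≡ r i) ×
  (∀ j → sum (λ i → entry (T i j)) ≡ c j)

Vertex : ∀ {m n} → Object m n → Set
Vertex {m} {n} T = Σ[ p ∈ Cell m n ] p ∈ T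

Adjacent : ∀ {m n} (T : Object m n) → Vertex T → Vertex T → Set
Adjacent T ((i , j) , _) ((i′ , j′) , _) =
  ∣ toℕ i - toℕ i′ ∣ + ∣ toℕ j - toℕ j′ ∣ ℕ.≤ 1

IsPolyomino : ∀ {m n} → Object m n → Set
IsPolyomino T = ∀ (u v : Vertex T) → Star (Adjacent T) u v

HConvex : ∀ {m n} → Object m n → Set
HConvex T = ∀ i p q → (i , p) ∈ T → (i , q) ∈ T →
            ∀ j → p ≤ j → j ≤ q → (i , j) ∈ T

VConvex : ∀ {m n} → Object m n → Set
VConvex T = ∀ j p q → (p , j) ∈ T → (q , j) ∈ T →
            ∀ i → p ≤ i → i ≤ q → (i , j) ∈ T

HVConvex : ∀ {m n} → Object m n → Set
HVConvex T = HConvex T × VConvex T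

AnchoredAt : ∀ {m n} .{{_ : NonZero n}} → Fin m → Fin m → Object m n → Set
AnchoredAt k l T = (k , first) ∈ T × (l , last) ∈ T

infix  8 ¬ᶠ_
infixr 5 _⇒ᶠ_
infixr 4 _∧ᶠ_

data Formula (V : Set) : Set where
  var  : V → Formula V
  ⊤ᶠ   : Formula V
  ¬ᶠ_  : Formula V → Formula V
  _⇒ᶠ_ : Formula V → Formula V → Formula V
  _∧ᶠ_ : Formula V → Formula V → Formula V
  ⋀    : ∀ {n} → (Fin n → Formula V) → Formula V

eval : ∀ {V} → (V → Bool) → Formula V → Bool
eval ρ (var x)  = ρ x
eval ρ ⊤ᶠ       = true
eval ρ (¬ᶠ φ)   = not (eval ρ φ)
eval ρ (φ ⇒ᶠ ψ) = not (eval ρ φ) ∨ eval ρ ψ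
eval ρ (φ ∧ᶠ ψ) = eval ρ φ ∧ eval ρ ψ
eval ρ (⋀ φ)    = foldr _∧_ true (λ i → eval ρ (φ i))

Satisfiable : ∀ {V} → Formula V → Set
Satisfiable {V} φ = ∃[ ρ ] eval {V} ρ φ ≡ true

-- Restricts the range of a conjunction: instances failing the side
-- condition contribute no clause.
provided : ∀ {V} {P : Set} → Dec P → Formula V → Formula V
provided P? φ = if does P? then φ else ⊤ᶠ

data Symbol : Set where
  A B C D : Symbol

Var : ℕ → ℕ → Set
Var m n = Symbol × Fin m × Fin n

index : ∀ n → ℕ → Maybe (Fin n)
index n zero = nothing
index n (suc i) with i <? n
... | yes i<n = just (fromℕ< i<n)
... | no  _   = nothing

-- X ⟨ i , j ⟩ takes arbitrary 1-based indices, and is the constant true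
-- outside the grid.
_⟨_,_⟩ : ∀ {m n} → Symbol → ℕ → ℕ → Formula (Var m n)
_⟨_,_⟩ {m} {n} X i j with index m i | index n j
... | just i′ | just j′ = var (X , i′ , j′)
... | just _  | nothing = ⊤ᶠ
... | nothing | _       = ⊤ᶠ

infix 9 _⟨_,_⟩

module _ {m n : ℕ} where

  -- In i ∸ 1 and j ∸ 1 below, i and j are at least 1, so the subtraction
  -- is exact; the index 0 lies outside the grid.

  Cor : Formula (Var m n)
  Cor = ⋀ {n = m} λ i₀ → ⋀ {n = n} λ j₀ → let i = # i₀ ; j = # j₀ in
    (A ⟨ i , j ⟩ ⇒ᶠ A ⟨ i ∸ 1 , j ⟩) ∧ᶠ
    (A ⟨ i , j ⟩ ⇒ᶠ A ⟨ i , j ∸ 1 ⟩) ∧ᶠ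
    (B ⟨ i , j ⟩ ⇒ᶠ B ⟨ i ∸ 1 , j ⟩) ∧ᶠ
    (B ⟨ i , j ⟩ ⇒ᶠ B ⟨ i , j + 1 ⟩) ∧ᶠ
    (C ⟨ i , j ⟩ ⇒ᶠ C ⟨ i + 1 , j ⟩) ∧ᶠ
    (C ⟨ i , j ⟩ ⇒ᶠ C ⟨ i , j ∸ 1 ⟩) ∧ᶠ
    (D ⟨ i , j ⟩ ⇒ᶠ D ⟨ i + 1 , j ⟩) ∧ᶠ
    (D ⟨ i , j ⟩ ⇒ᶠ D ⟨ i , j + 1 ⟩)

  Dis : Formula (Var m n)
  Dis = ⋀ {n = m} λ i₀ → ⋀ {n = n} λ j₀ → let i = # i₀ ; j = # j₀ in
    (A ⟨ i , j ⟩ ⇒ᶠ ¬ᶠ B ⟨ i , j ⟩) ∧ᶠ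
    (A ⟨ i , j ⟩ ⇒ᶠ ¬ᶠ C ⟨ i , j ⟩) ∧ᶠ
    (A ⟨ i , j ⟩ ⇒ᶠ ¬ᶠ D ⟨ i , j ⟩) ∧ᶠ
    (B ⟨ i , j ⟩ ⇒ᶠ ¬ᶠ A ⟨ i , j ⟩) ∧ᶠ
    (B ⟨ i , j ⟩ ⇒ᶠ ¬ᶠ C ⟨ i , j ⟩) ∧ᶠ
    (B ⟨ i , j ⟩ ⇒ᶠ ¬ᶠ D ⟨ i , j ⟩) ∧ᶠ
    (C ⟨ i , j ⟩ ⇒ᶠ ¬ᶠ A ⟨ i , j ⟩) ∧ᶠ
    (C ⟨ i , j ⟩ ⇒ᶠ ¬ᶠ B ⟨ i , j ⟩) ∧ᶠ
    (C ⟨ i , j ⟩ ⇒ᶠ ¬ᶠ D ⟨ i , j ⟩) ∧ᶠ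
    (D ⟨ i , j ⟩ ⇒ᶠ ¬ᶠ A ⟨ i , j ⟩) ∧ᶠ
    (D ⟨ i , j ⟩ ⇒ᶠ ¬ᶠ B ⟨ i , j ⟩) ∧ᶠ
    (D ⟨ i , j ⟩ ⇒ᶠ ¬ᶠ C ⟨ i , j ⟩)

  Con : Formula (Var m n)
  Con = ⋀ {n = m} λ i₀ → ⋀ {n = n} λ j₀ → let i = # i₀ ; j = # j₀ in
    (A ⟨ i , j ⟩ ⇒ᶠ ¬ᶠ D ⟨ i + 1 , j + 1 ⟩) ∧ᶠ
    (B ⟨ i , j ⟩ ⇒ᶠ ¬ᶠ C ⟨ i + 1 , j ∸ 1 ⟩)

  Anc : Fin m → Fin m → Formula (Var m n)
  Anc k l =
    ¬ᶠ A ⟨ # k , 1 ⟩ ∧ᶠ ¬ᶠ B ⟨ # k , 1 ⟩ ∧ᶠ ¬ᶠ C ⟨ # k , 1 ⟩ ∧ᶠ ¬ᶠ D ⟨ # k , 1 ⟩ ∧ᶠ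
    ¬ᶠ A ⟨ # l , n ⟩ ∧ᶠ ¬ᶠ B ⟨ # l , n ⟩ ∧ᶠ ¬ᶠ C ⟨ # l , n ⟩ ∧ᶠ ¬ᶠ D ⟨ # l , n ⟩

  LBC : Vector ℕ n → Formula (Var m n)
  LBC c =
    (⋀ {n = m} λ i₀ → ⋀ {n = n} λ j₀ → let i = # i₀ ; j = # j₀ in
      (A ⟨ i , j ⟩ ⇒ᶠ ¬ᶠ C ⟨ i + c j₀ , j ⟩) ∧ᶠ
      (A ⟨ i , j ⟩ ⇒ᶠ ¬ᶠ D ⟨ i + c j₀ , j ⟩) ∧ᶠ
      (B ⟨ i , j ⟩ ⇒ᶠ ¬ᶠ C ⟨ i + c j₀ , j ⟩) ∧ᶠ
      (B ⟨ i , j ⟩ ⇒ᶠ ¬ᶠ D ⟨ i + c j₀ , j ⟩)) ∧ᶠ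
    (⋀ {n = n} λ j₀ → let j = # j₀ in
      ¬ᶠ C ⟨ c j₀ , j ⟩ ∧ᶠ ¬ᶠ D ⟨ c j₀ , j ⟩)

  UBR : Vector ℕ m → Fin m → Fin m → Formula (Var m n)
  UBR r k₀ l₀ = ⋀ {n = m} λ i₀ → ⋀ {n = n} λ j₀ →
    let i = # i₀ ; j = # j₀ ; k = # k₀ ; l = # l₀ in
    provided (i ≤? k ⊓ l)
      (¬ᶠ A ⟨ i , j ⟩ ⇒ᶠ B ⟨ i , j + r i₀ ⟩) ∧ᶠ
    provided (k ≤? i) (provided (i ≤? l)
      (¬ᶠ C ⟨ i , j ⟩ ⇒ᶠ B ⟨ i , j + r i₀ ⟩)) ∧ᶠ
    provided (l ≤? i) (provided (i ≤? k)
      (¬ᶠ A ⟨ i , j ⟩ ⇒ᶠ D ⟨ i , j + r i₀ ⟩)) ∧ᶠ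
    provided (k ⊔ l ≤? i)
      (¬ᶠ C ⟨ i , j ⟩ ⇒ᶠ D ⟨ i , j + r i₀ ⟩)

  F : Fin m → Fin m → Vector ℕ m → Vector ℕ n → Formula (Var m n)
  F k l r c = Cor ∧ᶠ Dis ∧ᶠ Con ∧ᶠ Anc k l ∧ᶠ LBC c ∧ᶠ UBR r k l

{-# OPTIONS --safe #-}
module Submission where

open import Defs
open import Data.Bool.Base using (Bool; true; false; not; _∧_; _∨_)
import Data.Bool.Properties as Bool
open import Data.Empty using (⊥; ⊥-elim)
open import Data.Fin.Base as Fin using (Fin; zero; suc; toℕ; fromℕ<; inject₁)
open import Data.Fin.Properties using (toℕ-injective; toℕ<n; toℕ-fromℕ; toℕ-fromℕ<; fromℕ<-toℕ; toℕ-inject₁; all?)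
open import Data.Maybe.Base using (just; nothing)
open import Data.Nat.Base using (ℕ; zero; suc; _+_; _∸_; _≤_; _<_; z≤n; s≤s; s≤s⁻¹; z<s; _⊓_; _⊔_; NonZero; ∣_-_∣)
open import Data.Nat.Properties
open import Data.Product.Base using (Σ-syntax; ∃-syntax; _×_; _,_; proj₁; proj₂)
open import Data.Sum.Base using (_⊎_; inj₁; inj₂; [_,_]′)
open import Data.Unit.Base using (⊤; tt)
open import Data.Vec.Functional using (Vector; foldr)
open import Function.Base using (_∘_; id)
open import Function.Bundles using (_⇔_; mk⇔)
open import Algebra.Properties.CommutativeMonoid.Sum +-0-commutativeMonoid using (∑-comm)
open import Relation.Binary.Construct.Closure.ReflexiveTransitive using (Star; ε; _◅_; _◅◅_; reverse)
open import Relation.Binary.PropositionalEquality.Core using (_≡_; refl; sym; trans; cong; cong₂; subst; subst₂)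
open import Relation.Nullary.Decidable using (Dec; yes; no; does; dec-true; _×-dec_; _→-dec_)
open import Relation.Nullary.Negation.Core using (¬_; contradiction)

-- Given a satisfying assignment, let T be the set of cells in none of the
-- corners A, B, C, D.  UBR bounds each row count of T above by r i, LBC bounds
-- each column count below by c j, and since the two totals agree all bounds are
-- attained.  Con makes consecutive rows overlap, so T is connected.
--
-- Conversely, the anchors split the complement of T: cells left of their row
-- belong to A or C according to their position relative to row k, cells right
-- of it to B or D relative to row l.  That these corners are closed vertically
-- says that the rows meeting {columns ≤ j} (resp. {columns ≥ j}) form an
-- interval: if row i were skipped, T would have to leave the half-plane through
-- column j both above and below row i, contradicting v-convexity.

-- Semantics of formulas

infix 3 _⊨_

-- Satisfaction is valued in types, so that the clauses of a model become functions to apply and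
-- tuples to project from.
_⊨_ : ∀ {V} → (V → Bool) → Formula V → Set
ρ ⊨ var x    = ρ x ≡ true
ρ ⊨ ⊤ᶠ       = ⊤
ρ ⊨ ¬ᶠ φ     = ¬ (ρ ⊨ φ)
ρ ⊨ φ ⇒ᶠ ψ   = ρ ⊨ φ → ρ ⊨ ψ
ρ ⊨ φ ∧ᶠ ψ   = (ρ ⊨ φ) × (ρ ⊨ ψ)
ρ ⊨ ⋀ φ      = ∀ i → ρ ⊨ φ i

foldr-∧⁻ : ∀ {n} (f : Vector Bool n) → foldr _∧_ true f ≡ true → ∀ i → f i ≡ true
foldr-∧⁻ {suc n} f e i with f zero in e₀
foldr-∧⁻ {suc n} f e  zero    | true = e₀
foldr-∧⁻ {suc n} f e  (suc i) | true = foldr-∧⁻ (f ∘ suc) e i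
foldr-∧⁻ {suc n} f () i       | false

foldr-∧⁺ : ∀ {n} (f : Vector Bool n) → (∀ i → f i ≡ true) → foldr _∧_ true f ≡ true
foldr-∧⁺ {zero}  f e = refl
foldr-∧⁺ {suc n} f e rewrite e zero = foldr-∧⁺ (f ∘ suc) (e ∘ suc)

-- Both directions are proved together, because negation and the premise of an implication swap
-- them.
eval⇒⊨ : ∀ {V} (ρ : V → Bool) φ → eval ρ φ ≡ true → ρ ⊨ φ
⊨⇒eval : ∀ {V} (ρ : V → Bool) φ → ρ ⊨ φ → eval ρ φ ≡ true

eval⇒⊨ ρ (var x)  e = e
eval⇒⊨ ρ ⊤ᶠ       e = tt
eval⇒⊨ ρ (¬ᶠ φ)   e s with eval ρ φ | ⊨⇒eval ρ φ s
eval⇒⊨ ρ (¬ᶠ φ)   () s | true | _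
eval⇒⊨ ρ (φ ⇒ᶠ ψ) e s with eval ρ φ | ⊨⇒eval ρ φ s
... | true | _ = eval⇒⊨ ρ ψ e
eval⇒⊨ ρ (φ ∧ᶠ ψ) e with eval ρ φ in eφ
eval⇒⊨ ρ (φ ∧ᶠ ψ) e  | true = eval⇒⊨ ρ φ eφ , eval⇒⊨ ρ ψ e
eval⇒⊨ ρ (φ ∧ᶠ ψ) () | false
eval⇒⊨ ρ (⋀ φ)    e i = eval⇒⊨ ρ (φ i) (foldr-∧⁻ (λ i → eval ρ (φ i)) e i)

⊨⇒eval ρ (var x)  s = s
⊨⇒eval ρ ⊤ᶠ       s = refl
⊨⇒eval ρ (¬ᶠ φ)   s with eval ρ φ in eφ
... | true  = ⊥-elim (s (eval⇒⊨ ρ φ eφ))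
... | false = refl
⊨⇒eval ρ (φ ⇒ᶠ ψ) s with eval ρ φ in eφ
... | true  = ⊨⇒eval ρ ψ (s (eval⇒⊨ ρ φ eφ))
... | false = refl
⊨⇒eval ρ (φ ∧ᶠ ψ) (s , t) rewrite ⊨⇒eval ρ φ s = ⊨⇒eval ρ ψ t
⊨⇒eval ρ (⋀ φ)    s = foldr-∧⁺ (λ i → eval ρ (φ i)) (λ i → ⊨⇒eval ρ (φ i) (s i))

provided⁻ : ∀ {V} (ρ : V → Bool) {P : Set} (P? : Dec P) φ → ρ ⊨ provided P? φ → P → ρ ⊨ φ
provided⁻ ρ (yes _) φ s p = s
provided⁻ ρ (no ¬p) φ s p = contradiction p ¬p

provided⁺ : ∀ {V} (ρ : V → Bool) {P : Set} (P? : Dec P) φ → (P → ρ ⊨ φ) → ρ ⊨ provided P? φ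
provided⁺ ρ (yes p) φ s = s p
provided⁺ ρ (no _)  φ s = tt

index-just : ∀ n x {i} → index n x ≡ just i → # i ≡ x
index-just n (suc x) e with x <? n
index-just n (suc x) refl | yes x<n = cong suc (toℕ-fromℕ< x<n)

index-# : ∀ {n} (i : Fin n) → index n (# i) ≡ just i
index-# {n} i with toℕ i <? n
... | yes i<n = cong just (fromℕ<-toℕ i i<n)
... | no  i≮n = contradiction (toℕ<n i) i≮n

-- The value of X ⟨ x , y ⟩; off the grid the condition is vacuous, which
-- matches the convention that such symbols are true.
Atom : ∀ {m n} → (Var m n → Bool) → Symbol → ℕ → ℕ → Set
Atom ρ X x y = ∀ i j → # i ≡ x → # j ≡ y → ρ (X , i , j) ≡ true

⊨⇒Atom : ∀ {m n} (ρ : Var m n → Bool) X x y → ρ ⊨ X ⟨ x , y ⟩ → Atom ρ X x y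
⊨⇒Atom {m} {n} ρ X .(# i) .(# j) s i j refl refl
  with index m (# i) | index-# i | index n (# j) | index-# j
... | _ | refl | _ | refl = s

Atom⇒⊨ : ∀ {m n} (ρ : Var m n → Bool) X x y → Atom ρ X x y → ρ ⊨ X ⟨ x , y ⟩
Atom⇒⊨ {m} {n} ρ X x y a with index m x in ex | index n y in ey
... | just i  | just j  = a i j (index-just m x ex) (index-just n y ey)
... | just _  | nothing = tt
... | nothing | _       = tt

-- Counting

Count : ∀ {n} → (Fin n → Bool) → ℕ
Count f = sum (λ i → entry (f i))

count-prefix : ∀ {n} (f : Fin n → Bool) w → (∀ p → f p ≡ true → toℕ p < w) → Count f ≤ w
count-prefix {zero}  f w h = z≤n
count-prefix {suc n} f w h with f zero in e
count-prefix {suc n} f w       h | false = count-prefix (f ∘ suc) w (λ p t → <⇒≤ (h (suc p) t))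
count-prefix {suc n} f zero    h | true with () ← h zero e
count-prefix {suc n} f (suc w) h | true =
  s≤s (count-prefix (f ∘ suc) w (λ p t → s≤s⁻¹ (h (suc p) t)))

-- At the first true position the hypothesis puts all the others less than `w` steps further on, and
-- `count-prefix` finishes.
count-window : ∀ {n} (f : Fin n → Bool) w →
  (∀ p q → f p ≡ true → f q ≡ true → toℕ q < toℕ p + w) → Count f ≤ w
count-window {zero}  f w h = z≤n
count-window {suc n} f w h with f zero in e
... | false = count-window (f ∘ suc) w (λ p q s t → s≤s⁻¹ (h (suc p) (suc q) s t))
... | true  = subst (λ b → entry b + Count (f ∘ suc) ≤ w) e
                (count-prefix f w (λ q t → h zero q e t))

-- The condition `a + w ≤ n` keeps the interval from being cut off at the end of the vector.
count-interval : ∀ {n} (f : Fin n → Bool) a w → a + w ≤ n →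
  (∀ p → a ≤ toℕ p → toℕ p < a + w → f p ≡ true) → w ≤ Count f
count-interval {n}     f a       zero    b h = z≤n
count-interval {zero}  f zero    (suc w) () h
count-interval {zero}  f (suc a) (suc w) () h
count-interval {suc n} f zero    (suc w) b h rewrite h zero z≤n z<s =
  s≤s (count-interval (f ∘ suc) zero w (s≤s⁻¹ b) (λ p _ t → h (suc p) z≤n (s≤s t)))
count-interval {suc n} f (suc a) w       b h = m≤n⇒m≤o+n (entry (f zero))
  (count-interval (f ∘ suc) a w (s≤s⁻¹ b) (λ p s t → h (suc p) (s≤s s) (s≤s t)))

count-positive : ∀ {n} (f : Fin n → Bool) → 0 < Count f → ∃[ p ] f p ≡ true
count-positive {suc n} f h with f zero in e
... | true  = zero , e
... | false with count-positive (f ∘ suc) h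
...   | p , t = suc p , t

sum-mono-≤ : ∀ {n} (f g : Vector ℕ n) → (∀ i → f i ≤ g i) → sum f ≤ sum g
sum-mono-≤ {zero}  f g h = z≤n
sum-mono-≤ {suc n} f g h = +-mono-≤ (h zero) (sum-mono-≤ (f ∘ suc) (g ∘ suc) (h ∘ suc))

-- The tails compare by monotonicity, so cancelling them from the reversed inequality pins the
-- heads; cancelling the heads instead leaves the reversed inequality for the tails.
sum-tight : ∀ {n} (f g : Vector ℕ n) → (∀ i → f i ≤ g i) → sum g ≤ sum f → ∀ i → f i ≡ g i
sum-tight {suc n} f g h s zero = ≤-antisym (h zero)
  (+-cancelʳ-≤ (sum (f ∘ suc)) (g zero) (f zero)
    (≤-trans (+-monoʳ-≤ (g zero) (sum-mono-≤ (f ∘ suc) (g ∘ suc) (h ∘ suc))) s))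
sum-tight {suc n} f g h s (suc i) = sum-tight (f ∘ suc) (g ∘ suc) (h ∘ suc)
  (+-cancelˡ-≤ (f zero) _ _ (≤-trans (+-monoˡ-≤ (sum (g ∘ suc)) (h zero)) s)) i

-- Stepping through Fin n

-- Induction on the distance `d` from `i`. The step may use that it stays between `i` and `i′`,
-- which walks along a row rely on.
ascend : ∀ {n} (S : Fin n → Set) {i i′ : Fin n} → i Fin.≤ i′ →
  (∀ p q → i Fin.≤ p → q Fin.≤ i′ → toℕ q ≡ suc (toℕ p) → S p → S q) → S i → S i′
ascend {n} S {i} {i′} i≤i′ step s =
  go (toℕ i′ ∸ toℕ i) i′ ≤-refl (sym (m∸n+n≡m i≤i′))
  where
  go : ∀ d p → p Fin.≤ i′ → toℕ p ≡ d + toℕ i → S p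
  go zero    p       _    e = subst S (sym (toℕ-injective e)) s
  go (suc d) (suc p) p≤i′ e =
    step (inject₁ p) (suc p)
      (subst (toℕ i ≤_) (sym e′) (m≤n+m (toℕ i) d))
      p≤i′ (cong suc (sym (toℕ-inject₁ p)))
      (go d (inject₁ p) (≤-trans (≤-reflexive (toℕ-inject₁ p)) (<⇒≤ p≤i′)) e′)
    where
    e′ : toℕ (inject₁ p) ≡ d + toℕ i
    e′ = trans (toℕ-inject₁ p) (suc-injective e)

-- Going down is going up with the predicate `S p → S i′`, starting from the identity at `i′`.
descend : ∀ {n} (S : Fin n → Set) {i i′ : Fin n} → i′ Fin.≤ i →
  (∀ p q → toℕ q ≡ suc (toℕ p) → S q → S p) → S i → S i′
descend S {i′ = i′} i′≤i step =
  ascend (λ p → S p → S i′) i′≤i (λ p q _ _ e f → f ∘ step p q e) id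

successor : ∀ {n} {x y : Fin n} → x Fin.< y → Σ[ z ∈ Fin n ] toℕ z ≡ suc (toℕ x)
successor {y = y} x<y = fromℕ< x+1<n , toℕ-fromℕ< x+1<n
  where x+1<n = ≤-<-trans x<y (toℕ<n y)

atIndex : ∀ {n} (p : Fin n) x → 0 < x → x ≤ # p → Σ[ i ∈ Fin n ] # i ≡ x
atIndex p (suc x) _ x≤p = fromℕ< x<n , cong suc (toℕ-fromℕ< x<n)
  where x<n = <-≤-trans x≤p (toℕ<n p)

toℕ-first : ∀ {n} .{{_ : NonZero n}} → toℕ (first {n}) ≡ 0
toℕ-first {suc n} = refl

#-last : ∀ {n} .{{_ : NonZero n}} → # (last {n}) ≡ n
#-last {suc n} = cong suc (toℕ-fromℕ n)

-- Satisfying assignments give polyominoes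

none : (Symbol → Bool) → Bool
none f = not (f A ∨ f B ∨ f C ∨ f D)

none⁻ : ∀ f → none f ≡ true → ∀ X → ¬ f X ≡ true
none⁻ f e X t with f A in eA | f B in eB | f C in eC | f D in eD
none⁻ f e A t | false | false | false | false = contradiction (trans (sym eA) t) λ ()
none⁻ f e B t | false | false | false | false = contradiction (trans (sym eB) t) λ ()
none⁻ f e C t | false | false | false | false = contradiction (trans (sym eC) t) λ ()
none⁻ f e D t | false | false | false | false = contradiction (trans (sym eD) t) λ ()

none? : ∀ f → (none f ≡ true) ⊎ (∃[ X ] f X ≡ true)
none? f with f A in eA | f B in eB | f C in eC | f D in eD
... | true  | _     | _     | _     = inj₂ (A , eA)
... | false | true  | _     | _     = inj₂ (B , eB)
... | false | false | true  | _     = inj₂ (C , eC)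
... | false | false | false | true  = inj₂ (D , eD)
... | false | false | false | false = inj₁ refl

-- The direction in which `Cor` propagates each symbol: `A` and `B` towards smaller row numbers, `C`
-- and `D` towards larger ones.
Vertical : ∀ {m} → Symbol → Fin m → Fin m → Set
Vertical A i i′ = i′ Fin.≤ i
Vertical B i i′ = i′ Fin.≤ i
Vertical C i i′ = i Fin.≤ i′
Vertical D i i′ = i Fin.≤ i′

Horizontal : ∀ {n} → Symbol → Fin n → Fin n → Set
Horizontal A j j′ = j′ Fin.≤ j
Horizontal B j j′ = j Fin.≤ j′
Horizontal C j j′ = j′ Fin.≤ j
Horizontal D j j′ = j Fin.≤ j′

≤-suc : ∀ {a b} → b ≡ suc a → a ≤ b
≤-suc {a} refl = n≤1+n a

#-suc : ∀ {n} {p q : Fin n} → toℕ q ≡ suc (toℕ p) → # q ≡ # p + 1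
#-suc {p = p} e = trans (cong suc e) (+-comm 1 (# p))

module Complement {m n} .{{_ : NonZero n}} (r : Vector ℕ m) (c : Vector ℕ n) (k l : Fin m)
  (ρ : Var m n → Bool) (model : ρ ⊨ F k l r c) where

  private
    cor = proj₁ model
    con = proj₁ (proj₂ (proj₂ model))
    anc = proj₁ (proj₂ (proj₂ (proj₂ model)))
    lbc = proj₁ (proj₂ (proj₂ (proj₂ (proj₂ model))))
    ubr = proj₂ (proj₂ (proj₂ (proj₂ (proj₂ model))))

  P : Symbol → Fin m → Fin n → Set
  P X i j = ρ (X , i , j) ≡ true

  T : Object m n
  T i j = none (λ X → ρ (X , i , j))

  free : ∀ {i j} → (i , j) ∈ T → ∀ X → ¬ P X i j
  free {i} {j} = none⁻ (λ X → ρ (X , i , j))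

  T? : ∀ i j → (i , j) ∈ T ⊎ (∃[ X ] P X i j)
  T? i j = none? (λ X → ρ (X , i , j))

  cell : ∀ X i j → P X i j → ρ ⊨ X ⟨ # i , # j ⟩
  cell X i j s = Atom⇒⊨ ρ X (# i) (# j) λ i′ j′ ei ej →
    subst₂ (P X) (sym (toℕ-injective (suc-injective ei))) (sym (toℕ-injective (suc-injective ej))) s

  vertical : ∀ X {i i′ j} → Vertical X i i′ → P X i j → P X i′ j
  vertical A {j = j} v = descend (λ i → P A i j) v λ p q e s →
    let (f , _) = cor q j in
    -- `# q ∸ 1` computes to `toℕ q`, which is the 1-based number of the preceding row `p`.
    ⊨⇒Atom ρ A (toℕ q) (# j) (f (cell A q j s)) p j (sym e) refl
  vertical B {j = j} v = descend (λ i → P B i j) v λ p q e s →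
    let (_ , _ , f , _) = cor q j in
    ⊨⇒Atom ρ B (toℕ q) (# j) (f (cell B q j s)) p j (sym e) refl
  vertical C {j = j} v = ascend (λ i → P C i j) v λ p q _ _ e s →
    let (_ , _ , _ , _ , f , _) = cor p j in
    ⊨⇒Atom ρ C (# p + 1) (# j) (f (cell C p j s)) q j (#-suc e) refl
  vertical D {j = j} v = ascend (λ i → P D i j) v λ p q _ _ e s →
    let (_ , _ , _ , _ , _ , _ , f , _) = cor p j in
    ⊨⇒Atom ρ D (# p + 1) (# j) (f (cell D p j s)) q j (#-suc e) refl

  horizontal : ∀ X {i j j′} → Horizontal X j j′ → P X i j → P X i j′
  horizontal A {i} h = descend (P A i) h λ p q e s →
    let (_ , f , _) = cor i q in
    ⊨⇒Atom ρ A (# i) (toℕ q) (f (cell A i q s)) i p refl (sym e)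
  horizontal B {i} h = ascend (P B i) h λ p q _ _ e s →
    let (_ , _ , _ , f , _) = cor i p in
    ⊨⇒Atom ρ B (# i) (# p + 1) (f (cell B i p s)) i q refl (#-suc e)
  horizontal C {i} h = descend (P C i) h λ p q e s →
    let (_ , _ , _ , _ , _ , f , _) = cor i q in
    ⊨⇒Atom ρ C (# i) (toℕ q) (f (cell C i q s)) i p refl (sym e)
  horizontal D {i} h = ascend (P D i) h λ p q _ _ e s →
    let (_ , _ , _ , _ , _ , _ , _ , f) = cor i p in
    ⊨⇒Atom ρ D (# i) (# p + 1) (f (cell D i p s)) i q refl (#-suc e)

  ¬AD : ∀ {i i′ j j′} → toℕ i′ ≡ suc (toℕ i) → toℕ j′ ≡ suc (toℕ j) → P A i j → ¬ P D i′ j′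
  ¬AD {i} {i′} {j} {j′} ei ej a d = proj₁ (con i j) (cell A i j a)
    (subst₂ (λ x y → ρ ⊨ D ⟨ x , y ⟩) (#-suc ei) (#-suc ej) (cell D i′ j′ d))

  ¬BC : ∀ {i i′ j j′} → toℕ i′ ≡ suc (toℕ i) → toℕ j′ ≡ suc (toℕ j) → P B i j′ → ¬ P C i′ j
  ¬BC {i} {i′} {j} {j′} ei ej b c = proj₂ (con i j′) (cell B i j′ b)
    (subst₂ (λ x y → ρ ⊨ C ⟨ x , y ⟩) (#-suc ei) (sym ej) (cell C i′ j c))

  -- A corner symbol at a cell in between would propagate to an end that is in `T`: `A` and `C` to
  -- `p`, `B` and `D` to `q`.
  hconvex : HConvex T
  hconvex i p q s t j p≤j j≤q with T? i j
  ... | inj₁ u       = u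
  ... | inj₂ (A , x) = contradiction (horizontal A p≤j x) (free s A)
  ... | inj₂ (B , x) = contradiction (horizontal B j≤q x) (free t B)
  ... | inj₂ (C , x) = contradiction (horizontal C p≤j x) (free s C)
  ... | inj₂ (D , x) = contradiction (horizontal D j≤q x) (free t D)

  vconvex : VConvex T
  vconvex j p q s t i p≤i i≤q with T? i j
  ... | inj₁ u       = u
  ... | inj₂ (A , x) = contradiction (vertical A p≤i x) (free s A)
  ... | inj₂ (B , x) = contradiction (vertical B p≤i x) (free s B)
  ... | inj₂ (C , x) = contradiction (vertical C i≤q x) (free t C)
  ... | inj₂ (D , x) = contradiction (vertical D i≤q x) (free t D)

  anchored : AnchoredAt k l T
  anchored with T? k first | T? l last | anc
  ... | inj₁ s | inj₁ t | _ = s , t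
  ... | inj₂ (X , x) | _ | nA , nB , nC , nD , _ = ⊥-elim (refute X x)
    where
    at : ∀ X → P X k first → ρ ⊨ X ⟨ # k , 1 ⟩
    at X x = subst (λ y → ρ ⊨ X ⟨ # k , y ⟩) (cong suc toℕ-first) (cell X k first x)
    refute : ∀ X → P X k first → ⊥
    refute A = nA ∘ at A
    refute B = nB ∘ at B
    refute C = nC ∘ at C
    refute D = nD ∘ at D
  ... | inj₁ _ | inj₂ (X , x) | _ , _ , _ , _ , nA , nB , nC , nD = ⊥-elim (refute X x)
    where
    at : ∀ X → P X l last → ρ ⊨ X ⟨ # l , n ⟩
    at X x = subst (λ y → ρ ⊨ X ⟨ # l , y ⟩) #-last (cell X l last x)
    refute : ∀ X → P X l last → ⊥
    refute A = nA ∘ at A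
    refute B = nB ∘ at B
    refute C = nC ∘ at C
    refute D = nD ∘ at D

  -- Overlap of consecutive rows

  Overlap : Fin m → Fin m → Set
  Overlap i i′ = ∃[ z ] ((i , z) ∈ T × (i′ , z) ∈ T)

  -- Walk right along row `i` from `x`, staying in `T` until an overlap is found or `y` is reached.
  -- If the walk is stuck between columns `p` and `q`, propagation leaves only `C` at `(i′ , p)` and
  -- `B` at `(i , q)`, which `Con` forbids.
  overlap-≤ : ∀ {i i′ x y} → toℕ i′ ≡ suc (toℕ i) → x Fin.≤ y →
    (i , x) ∈ T → (i′ , y) ∈ T → Overlap i i′
  overlap-≤ {i} {i′} {x} {y} e x≤y s t =
    [ id , (λ u → y , u , t) ]′ (ascend S x≤y step (inj₂ s))
    where
    S : Fin n → Set
    S z = Overlap i i′ ⊎ (i , z) ∈ T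
    step : ∀ p q → x Fin.≤ p → q Fin.≤ y → toℕ q ≡ suc (toℕ p) → S p → S q
    step p q _ q≤y e′ (inj₁ o) = inj₁ o
    step p q _ q≤y e′ (inj₂ u) with T? i′ p | T? i q
    ... | inj₁ v       | _      = inj₁ (p , u , v)
    ... | _            | inj₁ v = inj₂ v
    ... | inj₂ (A , a) | _ = contradiction (vertical A (≤-suc e) a) (free u A)
    ... | inj₂ (B , a) | _ = contradiction (horizontal B (≤-trans (≤-suc e′) q≤y) a) (free t B)
    ... | inj₂ (D , a) | _ = contradiction (horizontal D (≤-trans (≤-suc e′) q≤y) a) (free t D)
    ... | inj₂ (C , a) | inj₂ (A , b) = contradiction (horizontal A (≤-suc e′) b) (free u A)
    ... | inj₂ (C , a) | inj₂ (B , b) = contradiction a (¬BC e e′ b)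
    ... | inj₂ (C , a) | inj₂ (C , b) = contradiction (horizontal C (≤-suc e′) b) (free u C)
    ... | inj₂ (C , a) | inj₂ (D , b) =
      contradiction (horizontal D q≤y (vertical D (≤-suc e) b)) (free t D)

  -- Here the walk goes right along row `i′` from `y`; the only way to get stuck is `A` at `(i , p)`
  -- with `D` at `(i′ , q)`, the other pair excluded by `Con`.
  overlap-≥ : ∀ {i i′ x y} → toℕ i′ ≡ suc (toℕ i) → y Fin.≤ x →
    (i , x) ∈ T → (i′ , y) ∈ T → Overlap i i′
  overlap-≥ {i} {i′} {x} {y} e y≤x s t =
    [ id , (λ u → x , s , u) ]′ (ascend S y≤x step (inj₂ t))
    where
    S : Fin n → Set
    S z = Overlap i i′ ⊎ (i′ , z) ∈ T
    step : ∀ p q → y Fin.≤ p → q Fin.≤ x → toℕ q ≡ suc (toℕ p) → S p → S q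
    step p q _ q≤x e′ (inj₁ o) = inj₁ o
    step p q _ q≤x e′ (inj₂ u) with T? i p | T? i′ q
    ... | inj₁ v       | _      = inj₁ (p , v , u)
    ... | _            | inj₁ v = inj₂ v
    ... | inj₂ (C , a) | _ = contradiction (vertical C (≤-suc e) a) (free u C)
    ... | inj₂ (B , a) | _ = contradiction (horizontal B (≤-trans (≤-suc e′) q≤x) a) (free s B)
    ... | inj₂ (D , a) | _ = contradiction (horizontal D (≤-trans (≤-suc e′) q≤x) a) (free s D)
    ... | inj₂ (A , a) | inj₂ (A , b) = contradiction (horizontal A (≤-suc e′) b) (free u A)
    ... | inj₂ (A , a) | inj₂ (D , b) = contradiction b (¬AD e e′ a)
    ... | inj₂ (A , a) | inj₂ (C , b) = contradiction (horizontal C (≤-suc e′) b) (free u C)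
    ... | inj₂ (A , a) | inj₂ (B , b) =
      contradiction (horizontal B q≤x (vertical B (≤-suc e) b)) (free s B)

  rows-overlap : ∀ {i i′ x y} → toℕ i′ ≡ suc (toℕ i) →
    (i , x) ∈ T → (i′ , y) ∈ T → Overlap i i′
  rows-overlap {x = x} {y} e s t with ≤-total (toℕ x) (toℕ y)
  ... | inj₁ x≤y = overlap-≤ e x≤y s t
  ... | inj₂ y≤x = overlap-≥ e y≤x s t

  -- Bounds on row and column counts

  row-window : ∀ {i} X Y → (∀ {j j′} → j Fin.≤ j′ → P Y i j → P Y i j′) →
    (∀ j → ρ ⊨ ¬ᶠ X ⟨ # i , # j ⟩ ⇒ᶠ Y ⟨ # i , # j + r i ⟩) → Count (T i) ≤ r i
  -- If `q` were at least `p + r i`, the cell at `p`, being free of `X`, would force `Y` at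
  -- `p + r i`, and `Y` would spread right to `q`. Column `p + r i` is on the grid since `q` is, so
  -- the forced `Y` is a genuine variable.
  row-window {i} X Y mono clause = count-window (T i) (r i) λ p q s t → ≰⇒> λ p+r≤q →
    let (z , ez) = atIndex q (# p + r i) z<s (s≤s p+r≤q)
        y = ⊨⇒Atom ρ Y (# i) (# p + r i)
              (clause p λ x → free s X (⊨⇒Atom ρ X (# i) (# p) x i p refl refl)) i z refl ez
    in free t Y (mono (≤-trans (≤-reflexive (suc-injective ez)) p+r≤q) y)

  -- The four ranges in `UBR` cover all positions of `i` relative to `k` and `l`; each supplies the
  -- pair of symbols for `row-window`.
  row-bound : ∀ i → Count (T i) ≤ r i
  row-bound i with ≤-total (# i) (# k) | ≤-total (# i) (# l)
  ... | inj₁ i≤k | inj₁ i≤l = row-window A B (horizontal B) λ j →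
    let (f , _) = ubr i j in
    provided⁻ ρ (# i ≤? _) (¬ᶠ A ⟨ # i , # j ⟩ ⇒ᶠ B ⟨ # i , # j + r i ⟩) f (⊓-glb i≤k i≤l)
  ... | inj₂ k≤i | inj₁ i≤l = row-window C B (horizontal B) λ j →
    let (_ , f , _) = ubr i j ; φ = ¬ᶠ C ⟨ # i , # j ⟩ ⇒ᶠ B ⟨ # i , # j + r i ⟩ in
    provided⁻ ρ (# i ≤? # l) φ (provided⁻ ρ (# k ≤? # i) (provided (# i ≤? # l) φ) f k≤i) i≤l
  ... | inj₁ i≤k | inj₂ l≤i = row-window A D (horizontal D) λ j →
    let (_ , _ , f , _) = ubr i j ; φ = ¬ᶠ A ⟨ # i , # j ⟩ ⇒ᶠ D ⟨ # i , # j + r i ⟩ in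
    provided⁻ ρ (# i ≤? # k) φ (provided⁻ ρ (# l ≤? # i) (provided (# i ≤? # k) φ) f l≤i) i≤k
  ... | inj₂ k≤i | inj₂ l≤i = row-window C D (horizontal D) λ j →
    let (_ , _ , _ , f) = ubr i j in
    provided⁻ ρ (_ ≤? # i) (¬ᶠ C ⟨ # i , # j ⟩ ⇒ᶠ D ⟨ # i , # j + r i ⟩) f (⊔-lub k≤i l≤i)

  -- Searching upwards from row `t` finds the last `A` or `B` in the column. Its 1-based number `a`
  -- is also the 0-based number of the row after it, and `a ≡ 0` says that there is none.
  top-boundary : ∀ j t → t ≤ m → ∃[ a ]
    (a ≡ 0 ⊎ (∃[ i ] (# i ≡ a × (P A i j ⊎ P B i j)))) ×
    (∀ p → a ≤ toℕ p → toℕ p < t → ¬ P A p j × ¬ P B p j)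
  top-boundary j zero    _   = 0 , inj₁ refl , λ _ _ ()
  top-boundary j (suc t) t<m
    with ρ (A , fromℕ< t<m , j) Bool.≟ true | ρ (B , fromℕ< t<m , j) Bool.≟ true
  ... | yes a | _     = suc t , inj₂ (fromℕ< t<m , cong suc (toℕ-fromℕ< t<m) , inj₁ a) ,
    λ p t<p p≤t → contradiction p≤t (≤⇒≯ t<p)
  ... | no _  | yes b = suc t , inj₂ (fromℕ< t<m , cong suc (toℕ-fromℕ< t<m) , inj₂ b) ,
    λ p t<p p≤t → contradiction p≤t (≤⇒≯ t<p)
  ... | no ¬a | no ¬b with top-boundary j t (<⇒≤ t<m)
  ...   | a , top , clear = a , top , λ p a≤p p≤t →
    [ clear p a≤p
    , (λ p≡t → subst (λ i → ¬ P A i j × ¬ P B i j)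
                 (toℕ-injective (trans (toℕ-fromℕ< t<m) (sym p≡t))) (¬a , ¬b))
    ]′ (m<1+n⇒m<n∨m≡n p≤t)

  -- The separate clauses of `LBC` at row `c j` act as if a corner ended at a virtual row 0, so both
  -- cases give the same conclusion.
  column-clauses : ∀ j a → (a ≡ 0 ⊎ (∃[ i ] (# i ≡ a × (P A i j ⊎ P B i j)))) →
    (ρ ⊨ ¬ᶠ C ⟨ a + c j , # j ⟩) × (ρ ⊨ ¬ᶠ D ⟨ a + c j , # j ⟩)
  column-clauses j a (inj₁ refl) = proj₂ lbc j
  column-clauses j a (inj₂ (i , refl , inj₁ x)) =
    let (f , g , _) = proj₁ lbc i j in f (cell A i j x) , g (cell A i j x)
  column-clauses j a (inj₂ (i , refl , inj₂ x)) =
    let (_ , _ , f , g) = proj₁ lbc i j in f (cell B i j x) , g (cell B i j x)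

  -- The `c j` rows just after the last `A` or `B` are all in `T`: a `C` or `D` among them would
  -- spread down to row `a + c j`, where `LBC` denies it.
  column-bound : ∀ j → c j ≤ Count (λ i → T i j)
  column-bound j with top-boundary j m ≤-refl
  ... | a , top , clear = count-interval (λ i → T i j) a (c j) fits inside
    where
    ¬C : ¬ (ρ ⊨ C ⟨ a + c j , # j ⟩)
    ¬C = proj₁ (column-clauses j a top)
    ¬D : ¬ (ρ ⊨ D ⟨ a + c j , # j ⟩)
    ¬D = proj₂ (column-clauses j a top)

    -- Off the grid `C` counts as true, so denying it at row `a + c j` forces that row to exist.
    fits : a + c j ≤ m
    fits = ≮⇒≥ λ m<a+c → ¬C (Atom⇒⊨ ρ C (a + c j) (# j) λ i _ e _ →
      contradiction (subst (_≤ m) e (toℕ<n i)) (<⇒≱ m<a+c))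

    clear-below : ∀ X p → toℕ p < a + c j → (∀ {i i′} → i Fin.≤ i′ → P X i j → P X i′ j) →
      ¬ (ρ ⊨ X ⟨ a + c j , # j ⟩) → ¬ P X p j
    clear-below X p p<a+c mono ¬x x = ¬x (Atom⇒⊨ ρ X (a + c j) (# j) λ i j′ ei ej →
      subst (P X i) (sym (toℕ-injective (suc-injective ej)))
        (mono (s≤s⁻¹ (≤-trans p<a+c (≤-reflexive (sym ei)))) x))

    inside : ∀ p → a ≤ toℕ p → toℕ p < a + c j → T p j ≡ true
    inside p a≤p p<a+c with T? p j
    ... | inj₁ s       = s
    ... | inj₂ (A , x) = contradiction x (proj₁ (clear p a≤p (toℕ<n p)))
    ... | inj₂ (B , x) = contradiction x (proj₂ (clear p a≤p (toℕ<n p)))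
    ... | inj₂ (C , x) = contradiction x (clear-below C p p<a+c (vertical C) ¬C)
    ... | inj₂ (D , x) = contradiction x (clear-below D p p<a+c (vertical D) ¬D)

  -- Double counting closes the chain from `sum c` through `sum cols`, `sum rows` and `sum r` back
  -- to `sum c`, so every pointwise bound is tight.
  realization : sum r ≡ sum c → IsRealization r c T
  realization Σr≡Σc =
    sum-tight rows r row-bound (≤-trans (≤-reflexive Σr≡Σc) (≤-trans Σc≤Σcols (≤-reflexive (sym double)))) ,
    (λ j → sym (sum-tight c cols column-bound
      (≤-trans (≤-reflexive (sym double)) (≤-trans (sum-mono-≤ rows r row-bound) (≤-reflexive Σr≡Σc))) j))
    where
    rows : Vector ℕ m
    rows i = Count (T i)
    cols : Vector ℕ n
    cols j = Count (λ i → T i j)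
    double : sum rows ≡ sum cols
    double = ∑-comm (λ i j → entry (T i j))
    Σc≤Σcols : sum c ≤ sum cols
    Σc≤Σcols = sum-mono-≤ c cols column-bound

  -- Connectedness

  adjacent-sym : ∀ {u v} → Adjacent T u v → Adjacent T v u
  adjacent-sym {(i , j) , _} {(i′ , j′) , _} =
    subst (_≤ 1) (cong₂ _+_ (∣-∣-comm (toℕ i) (toℕ i′)) (∣-∣-comm (toℕ j) (toℕ j′)))

  ∣-∣-suc : ∀ {a b} → b ≡ suc a → ∣ a - b ∣ ≤ 1
  ∣-∣-suc {a} refl = ≤-reflexive (trans (cong (λ b → ∣ a - b ∣) (+-comm 1 a)) (∣m-m+n∣≡n a 1))

  adjacent-row : ∀ {i j j′ s t} → ∣ toℕ j - toℕ j′ ∣ ≤ 1 →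
    Adjacent T ((i , j) , s) ((i , j′) , t)
  adjacent-row {i} {j} {j′} h = subst (λ d → d + ∣ toℕ j - toℕ j′ ∣ ≤ 1) (sym (∣n-n∣≡0 (toℕ i))) h

  adjacent-column : ∀ {i i′ j s t} → ∣ toℕ i - toℕ i′ ∣ ≤ 1 →
    Adjacent T ((i , j) , s) ((i′ , j) , t)
  adjacent-column {i} {i′} {j} h =
    subst (_≤ 1) (sym (trans (cong (∣ toℕ i - toℕ i′ ∣ +_) (∣n-n∣≡0 (toℕ j))) (+-identityʳ _))) h

  row-path-≤ : ∀ {i x y} (s : (i , x) ∈ T) (t : (i , y) ∈ T) → x Fin.≤ y →
    Star (Adjacent T) ((i , x) , s) ((i , y) , t)
  row-path-≤ {i} {x} {y} s t x≤y =
    ascend (λ q → (u : (i , q) ∈ T) → Star (Adjacent T) ((i , x) , s) ((i , q) , u)) x≤y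
      (λ p q x≤p q≤y e path u →
        let v = hconvex i x y s t p x≤p (≤-trans (≤-suc e) q≤y)
        in path v ◅◅ (adjacent-row {s = v} {t = u} (∣-∣-suc e) ◅ ε))
      -- The two ends are the same cell with possibly different membership proofs; `Adjacent` allows
      -- distance 0, so one step joins them.
      (λ u → adjacent-row {s = s} {t = u} (subst (_≤ 1) (sym (∣n-n∣≡0 (toℕ x))) z≤n) ◅ ε)
      t

  row-path : ∀ {i x y} (s : (i , x) ∈ T) (t : (i , y) ∈ T) →
    Star (Adjacent T) ((i , x) , s) ((i , y) , t)
  row-path {x = x} {y} s t with ≤-total (toℕ x) (toℕ y)
  ... | inj₁ x≤y = row-path-≤ s t x≤y
  ... | inj₂ y≤x = reverse (λ {u} {v} → adjacent-sym {u} {v}) (row-path-≤ t s y≤x)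

  -- To pass from row `p` to the next row, go along row `p` to a common column of the two, step
  -- down, and continue along the new row.
  path-≤ : (∀ i → ∃[ x ] (i , x) ∈ T) → ∀ {i i′ x y} → i Fin.≤ i′ →
    (s : (i , x) ∈ T) (t : (i′ , y) ∈ T) → Star (Adjacent T) ((i , x) , s) ((i′ , y) , t)
  path-≤ inhabited {i} {x = x} i≤i′ s =
    ascend (λ q → ∀ {y} (t : (q , y) ∈ T) → Star (Adjacent T) ((i , x) , s) ((q , y) , t)) i≤i′
      (λ p q _ _ e path t →
        let (_ , u) = inhabited p ; (z , v , w) = rows-overlap e u t
        in path v ◅◅ (adjacent-column {s = v} {t = w} (∣-∣-suc e) ◅ row-path w t))
      (row-path s)

  polyomino : (∀ i → ∃[ x ] (i , x) ∈ T) → IsPolyomino T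
  polyomino inhabited ((i , x) , s) ((i′ , y) , t) with ≤-total (toℕ i) (toℕ i′)
  ... | inj₁ i≤i′ = path-≤ inhabited i≤i′ s t
  ... | inj₂ i′≤i = reverse (λ {u} {v} → adjacent-sym {u} {v}) (path-≤ inhabited i′≤i t s)

-- Polyominoes give satisfying assignments

row-inhabited : ∀ {m n} (r : Vector ℕ m) (c : Vector ℕ n) → (∀ i → 0 < r i) →
  (T : Object m n) → IsRealization r c T → ∀ i → ∃[ x ] (i , x) ∈ T
row-inhabited r c r>0 T (rows , _) i = count-positive (T i) (subst (0 <_) (sym (rows i)) (r>0 i))

true-does : ∀ {P : Set} (P? : Dec P) → does P? ≡ true → P
true-does (yes p) _ = p

-- Paths crossing a row

sum≤1 : ∀ a b → a + b ≤ 1 → a ≡ 0 ⊎ b ≡ 0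
sum≤1 zero    b h = inj₁ refl
sum≤1 (suc a) b h = inj₂ (m+n≡0⇒n≡0 a (n≤0⇒n≡0 (s≤s⁻¹ h)))

-- A unit step cannot jump over row `i`. This and `step-above` provide the region `R` for `exit`.
step-below : ∀ {m} {i p p′ : Fin m} → p Fin.< i → ∣ toℕ p - toℕ p′ ∣ ≤ 1 → p′ Fin.< i ⊎ p′ ≡ i
step-below {i = i} {p} {p′} p<i h with m≤n⇒m<n∨m≡n
  (≤-trans (m≤n+∣n-m∣ (toℕ p′) (toℕ p)) (≤-trans (+-monoʳ-≤ (toℕ p) h) (≤-trans (≤-reflexive (+-comm _ 1)) p<i)))
... | inj₁ p′<i = inj₁ p′<i
... | inj₂ e    = inj₂ (toℕ-injective e)

step-above : ∀ {m} {i p p′ : Fin m} → i Fin.< p → ∣ toℕ p - toℕ p′ ∣ ≤ 1 → i Fin.< p′ ⊎ p′ ≡ i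
step-above {i = i} {p} {p′} i<p h with m≤n⇒m<n∨m≡n
  (s≤s⁻¹ (≤-trans i<p (≤-trans (m≤n+∣m-n∣ (toℕ p) (toℕ p′)) (≤-trans (+-monoʳ-≤ (toℕ p′) h) (≤-reflexive (+-comm _ 1))))))
... | inj₁ i<p′ = inj₁ i<p′
... | inj₂ e    = inj₂ (toℕ-injective (sym e))

-- Follow a path that starts in R × H and ends outside H.  When row i, which
-- borders R, has no cell in H, the path can only leave R × H sideways.
exit : ∀ {m n} (T : Object m n) (R : Fin m → Set) (H : Fin n → Set) → (∀ x → Dec (H x)) →
  ∀ {i j} →
  (∀ {p p′} → R p → ∣ toℕ p - toℕ p′ ∣ ≤ 1 → R p′ ⊎ p′ ≡ i) →
  (∀ q → (i , q) ∈ T → ¬ H q) →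
  (∀ {p x z} → (p , x) ∈ T → H x → (p , z) ∈ T → ¬ H z → (p , j) ∈ T) →
  ∀ {p q x z} {s : (p , x) ∈ T} {t : (q , z) ∈ T} →
  Star (Adjacent T) ((p , x) , s) ((q , z) , t) → R p → H x → ¬ H z →
  ∃[ p′ ] (R p′ × (p′ , j) ∈ T)
exit T R H H? step empty cross ε Rp Hx ¬Hz = contradiction Hx ¬Hz
exit T R H H? step empty cross {p} {x = x} {s = s} (_◅_ {j = (p′ , x′) , s′} adj path) Rp Hx ¬Hz
  with sum≤1 _ _ adj
... | inj₁ ep with refl ← toℕ-injective {i = p} {p′} (∣m-n∣≡0⇒m≡n ep) | H? x′
...   | yes Hx′ = exit T R H H? step empty cross path Rp Hx′ ¬Hz
...   | no ¬Hx′ = p , Rp , cross s Hx s′ ¬Hx′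
exit T R H H? step empty cross {p} {x = x} (_◅_ {j = (p′ , x′) , s′} adj path) Rp Hx ¬Hz
    | inj₂ ex with refl ← toℕ-injective {i = x} {x′} (∣m-n∣≡0⇒m≡n ex)
    | step {p} {p′} Rp (m+n≤o⇒m≤o _ adj)
...   | inj₁ Rp′  = exit T R H H? step empty cross path Rp′ Hx ¬Hz
...   | inj₂ refl = contradiction Hx (empty x s′)

-- The first step of the path that gets past row `i` changes the row, hence keeps the column, and
-- must lead from row `i` to row `i′`.
row-crossing : ∀ {m n} (T : Object m n) {i i′} → toℕ i′ ≡ suc (toℕ i) →
  ∀ {p q x y} {s : (p , x) ∈ T} {t : (q , y) ∈ T} →
  Star (Adjacent T) ((p , x) , s) ((q , y) , t) → p Fin.≤ i → i Fin.< q →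
  ∃[ z ] ((i , z) ∈ T × (i′ , z) ∈ T)
row-crossing T e ε p≤i i<p = contradiction p≤i (<⇒≱ i<p)
row-crossing T {i} {i′} e {p} {x = x} {s = s} (_◅_ {j = (p′ , x′) , s′} adj path) p≤i i<q
  with toℕ p′ ≤? toℕ i
... | yes p′≤i = row-crossing T e path p′≤i i<q
... | no  p′≰i with sum≤1 _ _ adj
...   | inj₁ ep = contradiction (subst (_≤ toℕ i) (∣m-n∣≡0⇒m≡n ep) p≤i) p′≰i
...   | inj₂ ex with refl ← toℕ-injective {i = x} {x′} (∣m-n∣≡0⇒m≡n ex) =
  x , subst (λ q → (q , x) ∈ T) (toℕ-injective p≡i) s ,
      subst (λ q → (q , x) ∈ T) (toℕ-injective (trans p′≡1+i (sym e))) s′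
  where
  p′≤1+p : toℕ p′ ≤ suc (toℕ p)
  p′≤1+p = ≤-trans (m≤n+∣n-m∣ (toℕ p′) (toℕ p))
    (≤-trans (+-monoʳ-≤ (toℕ p) (m+n≤o⇒m≤o _ adj)) (≤-reflexive (+-comm _ 1)))
  p≡i : toℕ p ≡ toℕ i
  p≡i = ≤-antisym p≤i (s≤s⁻¹ (≤-trans (≰⇒> p′≰i) p′≤1+p))
  p′≡1+i : toℕ p′ ≡ suc (toℕ i)
  p′≡1+i = ≤-antisym (≤-trans p′≤1+p (s≤s p≤i)) (≰⇒> p′≰i)

-- `H` stands for the columns on one side of `j`, with `j` included. The hypothesis `cross` is where
-- h-convexity enters: a row with cells on both sides of the border contains its cell in column `j`.
half-plane-rows : ∀ {m n} (T : Object m n) → VConvex T → IsPolyomino T →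
  (∀ i → ∃[ x ] (i , x) ∈ T) →
  (H : Fin n → Set) → (∀ x → Dec (H x)) → ∀ {j} → H j →
  (∀ {p x z} → (p , x) ∈ T → H x → (p , z) ∈ T → ¬ H z → (p , j) ∈ T) →
  ∀ {a i b x y} → a Fin.≤ i → i Fin.≤ b → (a , x) ∈ T → H x → (b , y) ∈ T → H y →
  ¬ (∀ q → (i , q) ∈ T → ¬ H q)
half-plane-rows T vconvex polyomino inhabited H H? {j} Hj cross {a} {i} {b} {x} {y} a≤i i≤b s Hx t Hy empty
  with m≤n⇒m<n∨m≡n a≤i | m≤n⇒m<n∨m≡n i≤b
... | inj₂ e | _ with refl ← toℕ-injective {i = a} {i} e = empty x s Hx
... | inj₁ _ | inj₂ e with refl ← toℕ-injective {i = i} {b} e = empty y t Hy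
... | inj₁ a<i | inj₁ i<b =
  -- Both paths aim at a cell of row `i`, which is outside `H` by assumption, so each must leave `H`
  -- before reaching that row.
  let (z , u) = inhabited i
      (p , p<i , v) = exit T (Fin._< i) H H? (step-below {i = i}) empty cross
                        (polyomino (_ , s) (_ , u)) a<i Hx (empty z u)
      (q , i<q , w) = exit T (i Fin.<_) H H? (step-above {i = i}) empty cross
                        (polyomino (_ , t) (_ , u)) i<b Hy (empty z u)
  in empty j (vconvex j p q v w i (<⇒≤ p<i) (<⇒≤ i<q)) Hj

-- Unordered, so that the corners above and below an anchor row share one spreading lemma.
Between : ∀ {m} → Fin m → Fin m → Fin m → Set
Between a i b = (a Fin.≤ i × i Fin.≤ b) ⊎ (b Fin.≤ i × i Fin.≤ a)

-- Corners cut out by a convex polyomino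

module Corners {m n} .{{_ : NonZero n}} (r : Vector ℕ m) (c : Vector ℕ n)
  (r>0 : ∀ i → 0 < r i) (c>0 : ∀ j → 0 < c j) (k l : Fin m)
  (T : Object m n) (realization : IsRealization r c T) (hconvex : HConvex T) (vconvex : VConvex T)
  (polyomino : IsPolyomino T) (anchored : AnchoredAt k l T) where

  inhabited : ∀ i → ∃[ x ] (i , x) ∈ T
  inhabited = row-inhabited r c r>0 T realization

  LeftOf RightOf : Fin m → Fin n → Set
  LeftOf  i j = ∀ q → (i , q) ∈ T → j Fin.< q
  RightOf i j = ∀ q → (i , q) ∈ T → q Fin.< j

  LeftOf? : ∀ i j → Dec (LeftOf i j)
  LeftOf? i j = all? λ q → (T i q Bool.≟ true) →-dec (toℕ j <? toℕ q)

  RightOf? : ∀ i j → Dec (RightOf i j)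
  RightOf? i j = all? λ q → (T i q Bool.≟ true) →-dec (toℕ q <? toℕ j)

  ¬Left-k : ∀ {j} → ¬ LeftOf k j
  ¬Left-k {j} h = contradiction (subst (toℕ j <_) toℕ-first (h first (proj₁ anchored))) λ ()

  ¬Right-l : ∀ {j} → ¬ RightOf l j
  ¬Right-l {j} h = <⇒≱ (toℕ<n j) (subst (_≤ toℕ j) #-last (h last (proj₂ anchored)))

  ¬Left-Right : ∀ {i j} → LeftOf i j → ¬ RightOf i j
  ¬Left-Right {i} f g = let (q , s) = inhabited i in <-asym (f q s) (g q s)

  -- If row `i′` had a cell in the columns up to `j`, then so would row `i`, since row `k` has one
  -- at its anchor in the first column and `i` lies between the two.
  left-spreads : ∀ {i i′ j} → Between i′ i k → LeftOf i j → LeftOf i′ j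
  left-spreads {i} {i′} {j} between f q s = ≰⇒> λ q≤j →
    let cells = half-plane-rows T vconvex polyomino inhabited (Fin._≤ j) (λ x → toℕ x ≤? toℕ j) ≤-refl
                  (λ {p} {x} {z} s x≤j t z≰j → hconvex p x z s t j x≤j (<⇒≤ (≰⇒> z≰j)))
        empty = λ z t → <⇒≱ (f z t)
        first≤j = subst (_≤ toℕ j) (sym toℕ-first) z≤n
    in [ (λ (a≤i , i≤b) → cells a≤i i≤b s q≤j (proj₁ anchored) first≤j empty)
       , (λ (a≤i , i≤b) → cells a≤i i≤b (proj₁ anchored) first≤j s q≤j empty) ]′ between

  right-spreads : ∀ {i i′ j} → Between i′ i l → RightOf i j → RightOf i′ j
  right-spreads {i} {i′} {j} between f q s = ≰⇒> λ j≤q →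
    let cells = half-plane-rows T vconvex polyomino inhabited (j Fin.≤_) (λ x → toℕ j ≤? toℕ x) ≤-refl
                  (λ {p} {x} {z} s j≤x t j≰z → hconvex p z x t s j (<⇒≤ (≰⇒> j≰z)) j≤x)
        empty = λ z t → <⇒≱ (f z t)
        j≤last = s≤s⁻¹ (subst (toℕ j <_) (sym #-last) (toℕ<n j))
    in [ (λ (a≤i , i≤b) → cells a≤i i≤b s j≤q (proj₂ anchored) j≤last empty)
       , (λ (a≤i , i≤b) → cells a≤i i≤b (proj₂ anchored) j≤last s j≤q empty) ]′ between

  -- Row k has nothing on its left and row l nothing on its right, so the
  -- weak inequalities do not make the corners overlap.
  Q : Symbol → Fin m → Fin n → Set
  Q A i j = i Fin.≤ k × LeftOf i j
  Q B i j = i Fin.≤ l × RightOf i j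
  Q C i j = k Fin.≤ i × LeftOf i j
  Q D i j = l Fin.≤ i × RightOf i j

  Q? : ∀ X i j → Dec (Q X i j)
  Q? A i j = (toℕ i ≤? toℕ k) ×-dec LeftOf? i j
  Q? B i j = (toℕ i ≤? toℕ l) ×-dec RightOf? i j
  Q? C i j = (toℕ k ≤? toℕ i) ×-dec LeftOf? i j
  Q? D i j = (toℕ l ≤? toℕ i) ×-dec RightOf? i j

  off : ∀ X {i j} → Q X i j → ¬ (i , j) ∈ T
  off A (_ , f) s = <-irrefl refl (f _ s)
  off B (_ , f) s = <-irrefl refl (f _ s)
  off C (_ , f) s = <-irrefl refl (f _ s)
  off D (_ , f) s = <-irrefl refl (f _ s)

  spreads : ∀ X {i i′ j} → Vertical X i i′ → Q X i j → Q X i′ j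
  spreads A v (i≤k , f) = ≤-trans v i≤k , left-spreads  (inj₁ (v , i≤k)) f
  spreads B v (i≤l , f) = ≤-trans v i≤l , right-spreads (inj₁ (v , i≤l)) f
  spreads C v (k≤i , f) = ≤-trans k≤i v , left-spreads  (inj₂ (k≤i , v)) f
  spreads D v (l≤i , f) = ≤-trans l≤i v , right-spreads (inj₂ (l≤i , v)) f

  shrinks : ∀ X {i j j′} → Horizontal X j j′ → Q X i j → Q X i j′
  shrinks A h (b , f) = b , λ q s → ≤-<-trans h (f q s)
  shrinks B h (b , f) = b , λ q s → <-≤-trans (f q s) h
  shrinks C h (b , f) = b , λ q s → ≤-<-trans h (f q s)
  shrinks D h (b , f) = b , λ q s → <-≤-trans (f q s) h

  ¬AC : ∀ {i j} → Q A i j → ¬ Q C i j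
  ¬AC (i≤k , f) (k≤i , _) = ¬Left-k (subst (λ i → LeftOf i _) (toℕ-injective (≤-antisym i≤k k≤i)) f)

  ¬BD : ∀ {i j} → Q B i j → ¬ Q D i j
  ¬BD (i≤l , f) (l≤i , _) = ¬Right-l (subst (λ i → RightOf i _) (toℕ-injective (≤-antisym i≤l l≤i)) f)

  AtomQ : Symbol → ℕ → ℕ → Set
  AtomQ X x y = ∀ i j → # i ≡ x → # j ≡ y → Q X i j

  -- Strictness puts row `i + 1` on the grid, as `¬AD` needs: an off-grid `D` would count as true.
  A-above-k : ∀ {i j} → Q A i j → i Fin.< k
  A-above-k (i≤k , f) with m≤n⇒m<n∨m≡n i≤k
  ... | inj₁ i<k = i<k
  ... | inj₂ e   = contradiction (subst (λ i → LeftOf i _) (toℕ-injective e) f) ¬Left-k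

  B-above-l : ∀ {i j} → Q B i j → i Fin.< l
  B-above-l (i≤l , f) with m≤n⇒m<n∨m≡n i≤l
  ... | inj₁ i<l = i<l
  ... | inj₂ e   = contradiction (subst (λ i → RightOf i _) (toℕ-injective e) f) ¬Right-l

  consecutive : ∀ {i i′} → toℕ i′ ≡ suc (toℕ i) → ∃[ z ] ((i , z) ∈ T × (i′ , z) ∈ T)
  consecutive {i} {i′} e = let (_ , s) = inhabited i ; (_ , t) = inhabited i′ in
    row-crossing T e (polyomino (_ , s) (_ , t)) ≤-refl (≤-reflexive (sym e))

  -- A column `z` shared by rows `i` and `i + 1` would have to lie strictly between columns `j` and
  -- `j + 1`.
  ¬AD : ∀ {i j} → Q A i j → ¬ AtomQ D (# i + 1) (# j + 1)
  ¬AD {i} {j} a@(_ , f) d =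
    let (i′ , ei) = successor (A-above-k a)
        (q , s)   = inhabited i
        (j′ , ej) = successor (f q s)
        (z , u , v) = consecutive ei
        (_ , g) = d i′ j′ (#-suc ei) (#-suc ej)
    in <⇒≱ (f z u) (s≤s⁻¹ (subst (toℕ z <_) ej (g z v)))

  ¬BC : ∀ {i j} → Q B i j → ¬ AtomQ C (# i + 1) (toℕ j)
  ¬BC {i} {j} b@(_ , f) d =
    let (i′ , ei) = successor (B-above-l b)
        (q , s)   = inhabited i
        -- `toℕ j` is the 1-based number of the column before `j`; it is positive because row `i`
        -- has a cell left of `j`.
        (j′ , ej) = atIndex j (toℕ j) (≤-<-trans z≤n (f q s)) (n≤1+n _)
        (z , u , v) = consecutive ei
        (_ , g) = d i′ j′ (#-suc ei) ej
    in <⇒≱ (f z u) (subst (_≤ toℕ z) ej (g z v))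

  -- If the cells of column j lay strictly between a corner cell ending at
  -- row lo and one starting at row lo + c j, there would be at most c j - 1.
  column-room : ∀ Y {j} lo → (∀ {i i′} → i Fin.≤ i′ → Q Y i j → Q Y i′ j) →
    (∀ p → (p , j) ∈ T → lo ≤ toℕ p) → ¬ AtomQ Y (lo + c j) (# j)
  column-room Y {j} lo mono above y = go (c j) refl (c>0 j)
    where
    below : ∀ p → (p , j) ∈ T → # p < lo + c j
    below p s = ≰⇒> λ lo+c≤p →
      let (i , e) = atIndex p (lo + c j) (≤-trans (c>0 j) (m≤n+m (c j) lo)) lo+c≤p
      in off Y (mono (s≤s⁻¹ (≤-trans (≤-reflexive e) lo+c≤p)) (y i j e refl)) s

    go : ∀ w → w ≡ c j → ¬ 0 < w
    go (suc w) e _ = 1+n≰n (≤-trans (≤-reflexive (trans e (sym (proj₂ realization j))))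
      (count-window (λ i → T i j) w λ p q s t →
        s≤s⁻¹ (≤-trans (below q t)
          (≤-trans (≤-reflexive (trans (cong (lo +_) (sym e)) (+-suc lo w)))
            (s≤s (+-monoˡ-≤ w (above p s)))))))

  -- Otherwise row `i` has a cell `z` at or before `j` and a cell `q` at or after `j + r i`, and
  -- h-convexity fills at least `r i + 1` cells.
  row-tight : ∀ {i j j′} → ¬ LeftOf i j → # j′ ≡ # j + r i → RightOf i j′
  row-tight {i} {j} {j′} ¬f e q s = ≰⇒> λ j′≤q → ¬f λ z t → ≰⇒> λ z≤j →
    let z+r≤q = ≤-trans (+-monoˡ-≤ (r i) z≤j) (≤-trans (≤-reflexive (sym (suc-injective e))) j′≤q)
        z+1+r≤1+q = ≤-trans (≤-reflexive (+-suc (toℕ z) (r i))) (s≤s z+r≤q)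
    in 1+n≰n (≤-trans
         (count-interval (T i) (toℕ z) (suc (r i)) (≤-trans z+1+r≤1+q (toℕ<n q))
           (λ p z≤p p<w → hconvex i z q t s p z≤p (s≤s⁻¹ (≤-trans p<w z+1+r≤1+q))))
         (≤-reflexive (proj₁ realization i)))

  -- The assignment and its clauses

  ρ : Var m n → Bool
  ρ (X , i , j) = does (Q? X i j)

  ⊨⇒Q : ∀ X x y → ρ ⊨ X ⟨ x , y ⟩ → AtomQ X x y
  ⊨⇒Q X x y s i j ei ej = true-does (Q? X i j) (⊨⇒Atom ρ X x y s i j ei ej)

  Q⇒⊨ : ∀ X x y → AtomQ X x y → ρ ⊨ X ⟨ x , y ⟩
  Q⇒⊨ X x y a = Atom⇒⊨ ρ X x y λ i j ei ej → dec-true (Q? X i j) (a i j ei ej)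

  imply : ∀ X Y i j x y → (Q X i j → AtomQ Y x y) → ρ ⊨ X ⟨ # i , # j ⟩ ⇒ᶠ Y ⟨ x , y ⟩
  imply X Y i j x y h s = Q⇒⊨ Y x y (h (⊨⇒Q X (# i) (# j) s i j refl refl))

  forbid : ∀ X Y i j x y → (Q X i j → ¬ AtomQ Y x y) → ρ ⊨ X ⟨ # i , # j ⟩ ⇒ᶠ ¬ᶠ Y ⟨ x , y ⟩
  forbid X Y i j x y h s t = h (⊨⇒Q X (# i) (# j) s i j refl refl) (⊨⇒Q Y x y t)

  disjoint : ∀ X Y i j → (Q X i j → ¬ Q Y i j) → ρ ⊨ X ⟨ # i , # j ⟩ ⇒ᶠ ¬ᶠ Y ⟨ # i , # j ⟩
  disjoint X Y i j h = forbid X Y i j (# i) (# j) λ s t → h s (t i j refl refl)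

  vertical-clause : ∀ X i j x → (∀ i′ → # i′ ≡ x → Vertical X i i′) →
    ρ ⊨ X ⟨ # i , # j ⟩ ⇒ᶠ X ⟨ x , # j ⟩
  vertical-clause X i j x v = imply X X i j x (# j) λ s i′ j′ ei ej →
    subst (Q X i′) (sym (toℕ-injective (suc-injective ej))) (spreads X (v i′ ei) s)

  horizontal-clause : ∀ X i j y → (∀ j′ → # j′ ≡ y → Horizontal X j j′) →
    ρ ⊨ X ⟨ # i , # j ⟩ ⇒ᶠ X ⟨ # i , y ⟩
  horizontal-clause X i j y v = imply X X i j (# i) y λ s i′ j′ ei ej →
    subst (λ i → Q X i j′) (sym (toℕ-injective (suc-injective ei))) (shrinks X (v j′ ej) s)

  before : ∀ {s} {i i′ : Fin s} → # i′ ≡ toℕ i → i′ Fin.≤ i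
  before e = ≤-suc (sym e)

  after : ∀ {s} {i i′ : Fin s} → # i′ ≡ # i + 1 → i Fin.≤ i′
  after {i = i} e = ≤-suc (suc-injective (trans e (+-comm (# i) 1)))

  cor : ρ ⊨ Cor
  cor i j =
    vertical-clause   A i j (toℕ i) (λ _ → before) ,
    horizontal-clause A i j (toℕ j) (λ _ → before) ,
    vertical-clause   B i j (toℕ i) (λ _ → before) ,
    horizontal-clause B i j (# j + 1) (λ _ → after) ,
    vertical-clause   C i j (# i + 1) (λ _ → after) ,
    horizontal-clause C i j (toℕ j) (λ _ → before) ,
    vertical-clause   D i j (# i + 1) (λ _ → after) ,
    horizontal-clause D i j (# j + 1) (λ _ → after)

  dis : ρ ⊨ Dis
  dis i j =
    disjoint A B i j (λ (_ , f) (_ , g) → ¬Left-Right f g) ,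
    disjoint A C i j ¬AC ,
    disjoint A D i j (λ (_ , f) (_ , g) → ¬Left-Right f g) ,
    disjoint B A i j (λ (_ , g) (_ , f) → ¬Left-Right f g) ,
    disjoint B C i j (λ (_ , g) (_ , f) → ¬Left-Right f g) ,
    disjoint B D i j ¬BD ,
    disjoint C A i j (λ x y → ¬AC y x) ,
    disjoint C B i j (λ (_ , f) (_ , g) → ¬Left-Right f g) ,
    disjoint C D i j (λ (_ , f) (_ , g) → ¬Left-Right f g) ,
    disjoint D A i j (λ (_ , g) (_ , f) → ¬Left-Right f g) ,
    disjoint D B i j (λ x y → ¬BD y x) ,
    disjoint D C i j (λ (_ , g) (_ , f) → ¬Left-Right f g)

  con : ρ ⊨ Con
  con i j = forbid A D i j (# i + 1) (# j + 1) ¬AD , forbid B C i j (# i + 1) (toℕ j) ¬BC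

  anc : ρ ⊨ Anc k l
  anc = at-k A , at-k B , at-k C , at-k D , at-l A , at-l B , at-l C , at-l D
    where
    at-k : ∀ X → ρ ⊨ ¬ᶠ X ⟨ # k , 1 ⟩
    at-k X s = off X (⊨⇒Q X (# k) 1 s k first refl (cong suc toℕ-first)) (proj₁ anchored)
    at-l : ∀ X → ρ ⊨ ¬ᶠ X ⟨ # l , n ⟩
    at-l X s = off X (⊨⇒Q X (# l) n s l last refl #-last) (proj₂ anchored)

  lbc : ρ ⊨ LBC c
  lbc =
    (λ i j →
      forbid A C i j (# i + c j) (# j) (λ a → column-room C (# i) (spreads C) (under A (spreads A) a)) ,
      forbid A D i j (# i + c j) (# j) (λ a → column-room D (# i) (spreads D) (under A (spreads A) a)) ,
      forbid B C i j (# i + c j) (# j) (λ b → column-room C (# i) (spreads C) (under B (spreads B) b)) ,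
      forbid B D i j (# i + c j) (# j) (λ b → column-room D (# i) (spreads D) (under B (spreads B) b))) ,
    (λ j →
      -- With `lo` equal to 0 the lower bound on the cells of the column is trivial and `0 + c j`
      -- computes to `c j`.
      (λ s → column-room C 0 (spreads C) (λ _ _ → z≤n) (⊨⇒Q C (c j) (# j) s)) ,
      (λ s → column-room D 0 (spreads D) (λ _ _ → z≤n) (⊨⇒Q D (c j) (# j) s)))
    where
    -- `A` and `B` fill the column upwards from row `i`, so its cells in `T` have 0-based row number
    -- at least `# i`.
    under : ∀ X {i j} → (∀ {i i′} → i′ Fin.≤ i → Q X i j → Q X i′ j) →
      Q X i j → ∀ p → (p , j) ∈ T → # i ≤ toℕ p
    under X mono x p s = ≰⇒> λ p≤i → off X (mono p≤i x) s

  -- In the given range of rows `X` is the symbol on the left and `Y` the one on the right; failure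
  -- of `X` means failure of `LeftOf`, and `row-tight` turns this into `RightOf`.
  row-clause : ∀ X Y i j → (LeftOf i j → Q X i j) → (∀ {j′} → RightOf i j′ → Q Y i j′) →
    ρ ⊨ ¬ᶠ X ⟨ # i , # j ⟩ ⇒ᶠ Y ⟨ # i , # j + r i ⟩
  row-clause X Y i j left right ¬x = Q⇒⊨ Y (# i) (# j + r i) λ i′ j′ ei ej →
    subst (λ i → Q Y i j′) (sym (toℕ-injective (suc-injective ei)))
      (right (row-tight (λ f → ¬x (Q⇒⊨ X (# i) (# j) λ i″ j″ ei ej →
        subst₂ (Q X) (sym (toℕ-injective (suc-injective ei))) (sym (toℕ-injective (suc-injective ej)))
          (left f))) ej))

  ubr : ρ ⊨ UBR r k l
  ubr i j =
    provided⁺ ρ (# i ≤? # k ⊓ # l) _ (λ h →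
      row-clause A B i j (s≤s⁻¹ (m≤n⊓o⇒m≤n (# k) (# l) h) ,_) (s≤s⁻¹ (m≤n⊓o⇒m≤o (# k) (# l) h) ,_)) ,
    provided⁺ ρ (# k ≤? # i) _ (λ k≤i → provided⁺ ρ (# i ≤? # l) _ λ i≤l →
      row-clause C B i j (s≤s⁻¹ k≤i ,_) (s≤s⁻¹ i≤l ,_)) ,
    provided⁺ ρ (# l ≤? # i) _ (λ l≤i → provided⁺ ρ (# i ≤? # k) _ λ i≤k →
      row-clause A D i j (s≤s⁻¹ i≤k ,_) (s≤s⁻¹ l≤i ,_)) ,
    provided⁺ ρ (# k ⊔ # l ≤? # i) _ (λ h →
      row-clause C D i j (s≤s⁻¹ (m⊔n≤o⇒m≤o (# k) (# l) h) ,_) (s≤s⁻¹ (m⊔n≤o⇒n≤o (# k) (# l) h) ,_))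

  model : ρ ⊨ F k l r c
  model = cor , dis , con , anc , lbc , ubr

theorem2 : (m n : ℕ) .{{_ : NonZero m}} .{{_ : NonZero n}}
    (r : Vector ℕ m) (c : Vector ℕ n) →
    (∀ i → 0 < r i) → (∀ j → 0 < c j) →
    sum r ≡ sum c →
    (k l : Fin m) →
    Satisfiable (F {m} {n} k l r c) ⇔
    (∃[ T ] (IsRealization r c T × HVConvex T × IsPolyomino T × AnchoredAt k l T))
theorem2 m n r c r>0 c>0 Σr≡Σc k l = mk⇔ to from
  where
  to : Satisfiable (F {m} {n} k l r c) →
    ∃[ T ] (IsRealization r c T × HVConvex T × IsPolyomino T × AnchoredAt k l T)
  to (ρ , e) = T , realization Σr≡Σc , (hconvex , vconvex) ,
    -- Connectedness relies on nonempty rows, which follow from the row sums just established.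
    polyomino (row-inhabited r c r>0 T (realization Σr≡Σc)) , anchored
    where open Complement r c k l ρ (eval⇒⊨ ρ (F k l r c) e)

  from : ∃[ T ] (IsRealization r c T × HVConvex T × IsPolyomino T × AnchoredAt k l T) →
    Satisfiable (F {m} {n} k l r c)
  from (T , real , (hconvex , vconvex) , polyomino , anchored) =
    ρ , ⊨⇒eval ρ (F k l r c) model
    where open Corners r c r>0 c>0 k l T real hconvex vconvex polyomino anchored
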